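{- Let $G'$ and $H'$ be two non-trivial, connected graphs. Then $$r(G' \Box H') \le rc(G' \Box H') \le 2\,r(G' \Box H').$$
   Context: All graphs are finite, simple and undirected. A graph is trivial if it has order (number of vertices) 0 or 1, and non-trivial otherwise. For a connected graph $G$: $dist_G(u,v)$ is the length (number of edges) of a shortest path between $u$ and $v$; the eccentricity of a vertex $v$ is $ecc(v)=\max\{dist_G(v,u): u\in V(G)\}$; the radius is $r(G)=\min\{ecc(v): v\in V(G)\}$. An edge coloring of $G$ is any function from $E(G)$ to a set of colors (not necessarily proper). A path is a rainbow path if no two of its edges have the same color. An edge coloring is a rainbow coloring if every pair of vertices is connected by at least one rainbow path. The rainbow connection number $rc(G)$ of a connected graph $G$ is the minimum number of colors in a rainbow coloring of $G$. The Cartesian product $G \Box H$ has vertex set $V(G)\times V(H)$; two distinct vertices $[g_1,h_1]$ and $[g_2,h_2]$ are adjacent if and only if either $g_1=g_2$ and $(h_1,h_2)\in E(H)$, or $h_1=h_2$ and $(g_1,g_2)\in E(G)$. -}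

module Defs where

open import Data.Empty using (⊥-elim)
open import Data.Fin.Base as Fin using (Fin; combine; remQuot; finToFun; funToFin; fromℕ<)
import Data.Fin.Properties as Fin
open import Data.List.Base as List using (List; []; _∷_)
import Data.List.Extrema.Nat as Extrema
open import Data.List.Membership.Propositional using (_∈_)
open import Data.List.Membership.Propositional.Properties using (∈-lookup)
open import Data.List.Relation.Unary.All as All using (All; []; _∷_)
open import Data.List.Relation.Unary.Any using (here; there)
open import Data.List.Relation.Unary.AllPairs as AllPairs using ([]; _∷_)
open import Data.List.Relation.Unary.Unique.Propositional using (Unique)
import Data.List.Membership.DecPropositional as DecMembership
open import Data.Nat.Base as ℕ
  using (ℕ; zero; suc; _*_; _≤_; _<_; z≤n; s≤s; NonZero; NonTrivial)
import Data.Nat.Properties as ℕ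
open import Data.Product.Base using (∃; ∃-syntax; Σ; _×_; _,_; proj₁; proj₂)
open import Data.Product.Function.NonDependent.Propositional using (_×-↔_)
open import Data.Sum.Base using (_⊎_; inj₁; inj₂)
open import Data.Unit.Base using (tt)
open import Function.Base using (_∘_)
open import Function.Bundles using (_↔_; Inverse; Injection)
open import Function.Construct.Composition using (_↔-∘_)
open import Function.Construct.Symmetry using (↔-sym)
open import Function.Properties.Inverse using (↔⇒↣)
open import Relation.Binary.Definitions using (Decidable; DecidableEquality; Symmetric)
open import Relation.Binary.PropositionalEquality
  using (_≡_; _≢_; refl; sym; trans; cong; cong₂; subst)
open import Relation.Nullary.Decidable using (Dec; yes; no; map′; recompute; ¬?; _×-dec_; _⊎-dec_)
open import Relation.Nullary.Negation.Core using (¬_; contradiction)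
import Relation.Unary as Unary

record Least (P : ℕ → Set) : Set where
  field
    value   : ℕ
    holds   : P value
    minimal : ∀ {m} → P m → value ≤ m

least : {P : ℕ → Set} → Unary.Decidable P → ∃ P → Least P
least {P} P? (n , Pn) = go P? n Pn
  where
  go : {P : ℕ → Set} → Unary.Decidable P → ∀ n → P n → Least P
  go {P} P? n Pn with P? 0
  go {P} P? n       Pn | yes P0 = record { value = 0 ; holds = P0 ; minimal = λ _ → z≤n }
  go {P} P? zero    P0 | no ¬P0 = contradiction P0 ¬P0
  go {P} P? (suc n) Pn | no ¬P0 = record
    { value   = suc L.value
    ; holds   = L.holds
    ; minimal = λ { {zero} P0 → contradiction P0 ¬P0 ; {suc m} Pm → s≤s (L.minimal Pm) }
    }
    where module L = Least (go {P ∘ suc} (P? ∘ suc) n Pn)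

record Graph : Set₁ where
  field
    V       : Set
    order   : ℕ
    finite  : V ↔ Fin order
    Adj     : V → V → Set
    adj?    : Decidable Adj
    adj-sym : Symmetric Adj
    irrefl  : ∀ {v} → ¬ Adj v v

  index : V → Fin order
  index = Inverse.to finite

  vertex : Fin order → V
  vertex = Inverse.from finite

  vertex-index : ∀ v → vertex (index v) ≡ v
  vertex-index = Inverse.strictlyInverseʳ finite

  _≟_ : DecidableEquality V
  _≟_ = Fin.inj⇒≟ (↔⇒↣ finite)

  allVertices : List V
  allVertices = List.tabulate vertex

open Graph using (V; order)

module _ (G : Graph) where
  open Graph G hiding (V; order)

  infixr 5 _∷_

  data Walk : V G → V G → Set where
    []  : ∀ {u} → Walk u u
    _∷_ : ∀ {u w v} → Adj u w → Walk w v → Walk u v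

module _ {G : Graph} where
  open Graph G hiding (V; order)

  length : ∀ {u v} → Walk G u v → ℕ
  length []      = 0
  length (_ ∷ p) = suc (length p)

  -- Both endpoints are included.
  vertices : ∀ {u v} → Walk G u v → List (V G)
  vertices ([] {u})      = u ∷ []
  vertices (_∷_ {u} _ p) = u ∷ vertices p

  IsPath : ∀ {u v} → Walk G u v → Set
  IsPath p = Unique (vertices p)

  labels : {A : Set} → (∀ u v → .(Adj u v) → A) → ∀ {u v} → Walk G u v → List A
  labels f []                = []
  labels f (_∷_ {u} {w} e p) = f u w e ∷ labels f p

Connected : Graph → Set
Connected G = ∀ u v → ∃[ p ] IsPath {G} {u} {v} p

-- A function on the set of unordered edges: the colour may depend neither on
-- the proof of adjacency (hence the irrelevant argument) nor on the order of
-- the end vertices.  Not every colour in Fin k has to be used.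
record EdgeColouring (G : Graph) (k : ℕ) : Set where
  open Graph G hiding (V; order)
  field
    colour     : ∀ u v → .(Adj u v) → Fin k
    colour-sym : ∀ {u v} (e : Adj u v) → colour u v e ≡ colour v u (adj-sym e)

open EdgeColouring

module _ {G : Graph} {k : ℕ} (c : EdgeColouring G k) where

  IsRainbowPath : ∀ {u v} → Walk G u v → Set
  IsRainbowPath p = IsPath p × Unique (labels (colour c) p)

  IsRainbowColouring : Set
  IsRainbowColouring = ∀ u v → ∃[ p ] IsRainbowPath {u} {v} p

RainbowColourable : Graph → ℕ → Set
RainbowColourable G k = ∃[ c ] IsRainbowColouring {G} {k} c

module _ (G : Graph) where
  open Graph G hiding (V; order)

  anyVertex? : {P : V G → Set} → Unary.Decidable P → Dec (∃ P)
  anyVertex? {P} P? = map′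
    (λ (i , Pi) → vertex i , Pi)
    (λ (v , Pv) → index v , subst P (sym (vertex-index v)) Pv)
    (Fin.any? (P? ∘ vertex))

  allVertices? : {P : V G → Set} → Unary.Decidable P → Dec (∀ v → P v)
  allVertices? {P} P? = map′
    (λ Pi v → subst P (vertex-index v) (Pi (index v)))
    (λ Pv i → Pv (vertex i))
    (Fin.all? (P? ∘ vertex))

  walk? : {A : Set} (f : ∀ u v → .(Adj u v) → A) (Q : List (V G) → List A → Set) →
          (∀ xs as → Dec (Q xs as)) → ∀ l u v →
          Dec (∃[ p ] (length {G} {u} {v} p ≡ l × Q (vertices p) (labels f p)))
  walk? f Q Q? zero u v with u ≟ v
  ... | no u≢v = no λ { ([] , _) → u≢v refl ; (_ ∷ _ , () , _) }
  ... | yes refl with Q? (u ∷ []) []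
  ...   | yes q = yes ([] , refl , q)
  ...   | no ¬q = no λ { ([] , _ , q) → ¬q q ; (_ ∷ _ , () , _) }
  walk? {A} f Q Q? (suc l) u v = map′
    (λ { (w , e , p , refl , q) → e ∷ p , refl , q })
    (λ { (e ∷ p , refl , q) → _ , e , p , refl , q })
    (anyVertex? step?)
    where
    Step : V G → Set
    Step w = Σ (Adj u w) λ e → ∃[ p ] (length {G} {w} {v} p ≡ l ×
      Q (u ∷ vertices p) (f u w e ∷ labels f p))

    step? : Unary.Decidable Step
    step? w with adj? u w
    ... | no ¬e = no (¬e ∘ proj₁)
    ... | yes e = map′ (e ,_) proj₂
      (walk? f (λ xs as → Q (u ∷ xs) (f u w e ∷ as)) (λ xs as → Q? _ _) l w v)

  unique? : Unary.Decidable (Unique {A = V G})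
  unique? = AllPairs.allPairs? (λ x y → ¬? (x ≟ y))

  lookup-unique : {A : Set} {xs : List A} → Unique xs → ∀ {i j} →
                  List.lookup xs i ≡ List.lookup xs j → i ≡ j
  lookup-unique (_ ∷ _)  {Fin.zero}  {Fin.zero}  _  = refl
  lookup-unique (x∉ ∷ _) {Fin.zero}  {Fin.suc j} eq = contradiction eq (All.lookup x∉ (∈-lookup j))
  lookup-unique (x∉ ∷ _) {Fin.suc i} {Fin.zero}  eq = contradiction (sym eq) (All.lookup x∉ (∈-lookup i))
  lookup-unique (_ ∷ xs) {Fin.suc i} {Fin.suc j} eq = cong Fin.suc (lookup-unique xs eq)

  unique⇒length≤order : {xs : List (V G)} → Unique xs → List.length xs ≤ order G
  unique⇒length≤order {xs} xs! = Fin.injective⇒≤ {f = index ∘ List.lookup xs}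
    (lookup-unique xs! ∘ Injection.injective (↔⇒↣ finite))

  length-vertices : ∀ {u v} (p : Walk G u v) → List.length (vertices p) ≡ suc (length p)
  length-vertices []      = refl
  length-vertices (_ ∷ p) = cong suc (length-vertices p)

  path⇒length<order : ∀ {u v} (p : Walk G u v) → IsPath p → length p < order G
  path⇒length<order p p! = subst (_≤ order G) (length-vertices p) (unique⇒length≤order p!)

  pathOfLength? : ∀ u v d → Dec (∃[ p ] (length {G} {u} {v} p ≡ d × IsPath p))
  pathOfLength? u v d = walk? (λ _ _ _ → tt) (λ xs _ → Unique xs) (λ xs _ → unique? xs) d u v

  rainbowPath? : ∀ {k} (c : EdgeColouring G k) u v → Dec (∃[ p ] IsRainbowPath c {u} {v} p)
  rainbowPath? c u v = map′
    (λ (_ , p , _ , r) → p , r)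
    (λ (p , r) → fromℕ< (path⇒length<order p (proj₁ r)) , p , sym (Fin.toℕ-fromℕ< _) , r)
    (Fin.any? λ (l : Fin (order G)) → walk? (colour c) (λ xs as → Unique xs × Unique as)
      (λ xs as → unique? xs ×-dec AllPairs.allPairs? (λ x y → ¬? (x Fin.≟ y)) as) (Fin.toℕ l) u v)

  rainbowColouring? : ∀ {k} (c : EdgeColouring G k) → Dec (IsRainbowColouring c)
  rainbowColouring? c = allVertices? λ u → allVertices? λ v → rainbowPath? c u v

  module _ {k} {c c′ : EdgeColouring G k}
           (eq : ∀ {u v} (e : Adj u v) → colour c u v e ≡ colour c′ u v e) where

    labels-cong : ∀ {u v} (p : Walk G u v) → labels (colour c) p ≡ labels (colour c′) p
    labels-cong []      = refl
    labels-cong (e ∷ p) = cong₂ _∷_ (eq e) (labels-cong p)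

    rainbowColouring-cong : IsRainbowColouring c → IsRainbowColouring c′
    rainbowColouring-cong r u v =
      let p , p! , cs! = r u v in p , p! , subst Unique (labels-cong p) cs!

  -- An injective code for unordered pairs of vertices.
  pairBy : ∀ {i j : Fin (order G)} → Dec (i Fin.≤ j) → Fin (order G * order G)
  pairBy {i} {j} (yes _) = combine i j
  pairBy {i} {j} (no _)  = combine j i

  pair : Fin (order G) → Fin (order G) → Fin (order G * order G)
  pair i j = pairBy (i Fin.≤? j)

  pairBy-sym : ∀ {i j} (d : Dec (i Fin.≤ j)) (d′ : Dec (j Fin.≤ i)) → pairBy d ≡ pairBy d′
  pairBy-sym (yes i≤j) (yes j≤i) = cong₂ combine (Fin.≤-antisym i≤j j≤i) (Fin.≤-antisym j≤i i≤j)
  pairBy-sym (yes _)   (no _)    = refl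
  pairBy-sym (no _)    (yes _)   = refl
  pairBy-sym (no i≰j)  (no j≰i)  = contradiction (ℕ.≰⇒≥ i≰j) j≰i

  pair-sym : ∀ i j → pair i j ≡ pair j i
  pair-sym i j = pairBy-sym (i Fin.≤? j) (j Fin.≤? i)

  pairBy-combine : ∀ {i j} (d : Dec (i Fin.≤ j)) → pairBy d ≡ combine i j ⊎ pairBy d ≡ combine j i
  pairBy-combine (yes _) = inj₁ refl
  pairBy-combine (no _)  = inj₂ refl

  pair-combine : ∀ i j → pair i j ≡ combine i j ⊎ pair i j ≡ combine j i
  pair-combine i j = pairBy-combine (i Fin.≤? j)

  code : V G → V G → Fin (order G * order G)
  code u v = pair (index u) (index v)

  code-combine : ∀ u v → code u v ≡ combine (index u) (index v) ⊎ code u v ≡ combine (index v) (index u)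
  code-combine u v = pair-combine (index u) (index v)

  uncode : Fin (order G * order G) → V G × V G
  uncode x = let i , j = remQuot (order G) x in vertex i , vertex j

  uncode-combine : ∀ u v → uncode (combine (index u) (index v)) ≡ (u , v)
  uncode-combine u v = trans
    (cong (λ (i , j) → vertex i , vertex j) (Fin.remQuot-combine (index u) (index v)))
    (cong₂ _,_ (vertex-index u) (vertex-index v))

  uncode-code : ∀ u v → uncode (code u v) ≡ (u , v) ⊎ uncode (code u v) ≡ (v , u)
  uncode-code u v with code-combine u v
  ... | inj₁ eq = inj₁ (trans (cong uncode eq) (uncode-combine u v))
  ... | inj₂ eq = inj₂ (trans (cong uncode eq) (uncode-combine v u))

  colouringOf : ∀ {k} → (Fin (order G * order G) → Fin k) → EdgeColouring G k
  colouringOf f = record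
    { colour     = λ u v _ → f (code u v)
    ; colour-sym = λ {u} {v} _ → cong f (pair-sym (index u) (index v))
    }

  module _ {k} (c : EdgeColouring G (suc k)) where

    colourAt : V G × V G → Fin (suc k)
    colourAt (u , v) with adj? u v
    ... | yes e = colour c u v e
    ... | no _  = Fin.zero

    colourAt-edge : ∀ {u v} (e : Adj u v) → colourAt (u , v) ≡ colour c u v e
    colourAt-edge {u} {v} e with adj? u v
    ... | yes _ = refl
    ... | no ¬e = contradiction e ¬e

    colourAt-code : ∀ {u v} (e : Adj u v) → colour c u v e ≡ colourAt (uncode (code u v))
    colourAt-code {u} {v} e with uncode-code u v
    ... | inj₁ eq = sym (trans (cong colourAt eq) (colourAt-edge e))
    ... | inj₂ eq = trans (colour-sym c e)
      (sym (trans (cong colourAt eq) (colourAt-edge (adj-sym e))))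

  rainbowColourable? : Unary.Decidable (RainbowColourable G)
  rainbowColourable? zero with anyVertex? (λ u → anyVertex? (adj? u))
  ... | yes (u , v , e) = no λ (c , _) → Fin.¬Fin0 (colour c u v e)
  ... | no ¬e = map′ (c₀ ,_)
      (λ (c , r) → rainbowColouring-cong {c = c} {c₀} (λ e → ⊥-elim (¬e (_ , _ , e))) r)
      (rainbowColouring? c₀)
    where
    c₀ : EdgeColouring G 0
    c₀ = record
      { colour     = λ u v e → ⊥-elim (¬e (u , v , recompute-adj u v e))
      ; colour-sym = λ e → ⊥-elim (¬e (_ , _ , e))
      }
      where
      recompute-adj : ∀ u v → .(Adj u v) → Adj u v
      recompute-adj u v e = recompute (adj? u v) e
  rainbowColourable? (suc k) = map′
    (λ (i , r) → colouringOf (finToFun i) , r)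
    (λ (c , r) → funToFin (colourAt c ∘ uncode) ,
      rainbowColouring-cong {c = c} {c′ = colouringOf (finToFun (funToFin (colourAt c ∘ uncode)))}
        (λ {u} {v} e → trans (colourAt-code c e)
          (sym (Fin.finToFun-funToFin (colourAt c ∘ uncode) (code u v)))) r)
    (Fin.any? λ i → rainbowColouring? (colouringOf (finToFun i)))

  -- Giving distinct colours to distinct edges turns every path into a rainbow path.
  distinctColours : EdgeColouring G (order G * order G)
  distinctColours = colouringOf λ x → x

  start∈vertices : ∀ {u v} (p : Walk G u v) → u ∈ vertices p
  start∈vertices []      = here refl
  start∈vertices (_ ∷ _) = here refl

  code-fresh : ∀ {x y u v} (p : Walk G u v) → All (x ≢_) (vertices p) →
               All (code x y ≢_) (labels (colour distinctColours) p)
  code-fresh []      _           = []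
  code-fresh {x} {y} (_∷_ {a} {b} e p) (x≢a ∷ x∉p) = neq ∷ code-fresh p x∉p
    where
    x≢b : x ≢ b
    x≢b = All.lookup x∉p (start∈vertices p)

    neq : code x y ≢ code a b
    neq eq with uncode-code x y | uncode-code a b
    ... | inj₁ p | inj₁ q = x≢a (cong proj₁ (trans (sym p) (trans (cong uncode eq) q)))
    ... | inj₁ p | inj₂ q = x≢b (cong proj₁ (trans (sym p) (trans (cong uncode eq) q)))
    ... | inj₂ p | inj₁ q = x≢b (cong proj₂ (trans (sym p) (trans (cong uncode eq) q)))
    ... | inj₂ p | inj₂ q = x≢a (cong proj₂ (trans (sym p) (trans (cong uncode eq) q)))

  path⇒distinctColours : ∀ {u v} (p : Walk G u v) → IsPath p →
                         Unique (labels (colour distinctColours) p)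
  path⇒distinctColours []      _         = []
  path⇒distinctColours (_ ∷ p) (u∉ ∷ p!) = code-fresh p u∉ ∷ path⇒distinctColours p p!

module _ (G : Graph) (conn : Connected G) where
  open Graph G hiding (V; order)

  distance : ∀ u v → Least λ d → ∃[ p ] (length {G} {u} {v} p ≡ d × IsPath p)
  distance u v = least (pathOfLength? G u v)
    (let p , p! = conn u v in length p , p , refl , p!)

  dist : V G → V G → ℕ
  dist u v = Least.value (distance u v)

  -- The default value 0 is attained at dist v v.
  ecc : V G → ℕ
  ecc v = Extrema.max 0 (List.map (dist v) allVertices)

  radiusLeast : .{{NonZero (order G)}} → Least λ r → ∃[ v ] ecc v ≡ r
  radiusLeast = least (λ r → anyVertex? G λ v → ecc v ℕ.≟ r)
    (_ , vertex (fromℕ< (ℕ.>-nonZero⁻¹ (order G))) , refl)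

  radius : .{{NonZero (order G)}} → ℕ
  radius = Least.value radiusLeast

  rcLeast : Least (RainbowColourable G)
  rcLeast = least (rainbowColourable? G)
    (_ , distinctColours G , λ u v → let p , p! = conn u v in p , p! , path⇒distinctColours G p p!)

  rc : ℕ
  rc = Least.value rcLeast

infixr 7 _□_

_□_ : Graph → Graph → Graph
G □ H = record
  { V       = V G × V H
  ; order   = order G * order H
  ; finite  = ↔-sym Fin.*↔× ↔-∘ (G.finite ×-↔ H.finite)
  ; Adj     = λ (g₁ , h₁) (g₂ , h₂) → (g₁ ≡ g₂ × H.Adj h₁ h₂) ⊎ (h₁ ≡ h₂ × G.Adj g₁ g₂)
  ; adj?    = λ (g₁ , h₁) (g₂ , h₂) →
                (g₁ G.≟ g₂ ×-dec H.adj? h₁ h₂) ⊎-dec (h₁ H.≟ h₂ ×-dec G.adj? g₁ g₂)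
  ; adj-sym = λ { (inj₁ (eq , e)) → inj₁ (sym eq , H.adj-sym e)
                ; (inj₂ (eq , e)) → inj₂ (sym eq , G.adj-sym e) }
  ; irrefl  = λ { (inj₁ (_ , e)) → H.irrefl e ; (inj₂ (_ , e)) → G.irrefl e }
  }
  where
  module G = Graph G
  module H = Graph H

instance
  □-nonZero : ∀ {m n} → .{{NonTrivial m}} → .{{NonTrivial n}} → NonZero (m * n)
  □-nonZero {m} {n} = ℕ.m*n≢0 m n {{ℕ.nonTrivial⇒nonZero m}} {{ℕ.nonTrivial⇒nonZero n}}

module _ {G : Graph} where
  open Graph G hiding (V; order)

  infixr 5 _++_

  _++_ : ∀ {u v w} → Walk G u v → Walk G v w → Walk G u w
  []      ++ q = q
  (e ∷ p) ++ q = e ∷ (p ++ q)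

  suffix : ∀ {x u v} (p : Walk G u v) → IsPath p → x ∈ vertices p → ∃[ q ] IsPath {G} {x} {v} q
  suffix []      p!       (here refl) = [] , p!
  suffix (e ∷ p) p!       (here refl) = e ∷ p , p!
  suffix (e ∷ p) (_ ∷ p!) (there x∈p) = suffix p p! x∈p

  walk⇒path : ∀ {u v} → Walk G u v → ∃[ p ] IsPath {G} {u} {v} p
  walk⇒path []      = [] , [] ∷ []
  walk⇒path {u} (e ∷ p) with walk⇒path p
  ... | q , q! with DecMembership._∈?_ _≟_ u (vertices q)
  ...   | yes u∈q = suffix q q! u∈q
  ...   | no  u∉q = e ∷ q , All.tabulate (λ { x∈q refl → u∉q x∈q }) ∷ q!

module _ {G H : Graph} where

  walkˡ : ∀ {g₁ g₂} (h : V H) → Walk G g₁ g₂ → Walk (G □ H) (g₁ , h) (g₂ , h)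
  walkˡ h []      = []
  walkˡ h (e ∷ p) = inj₂ (refl , e) ∷ walkˡ h p

  walkʳ : ∀ (g : V G) {h₁ h₂} → Walk H h₁ h₂ → Walk (G □ H) (g , h₁) (g , h₂)
  walkʳ g []      = []
  walkʳ g (e ∷ p) = inj₁ (refl , e) ∷ walkʳ g p

  □-connected : Connected G → Connected H → Connected (G □ H)
  □-connected G-conn H-conn (g₁ , h₁) (g₂ , h₂) =
    walk⇒path (walkˡ h₁ (proj₁ (G-conn g₁ g₂)) ++ walkʳ g₂ (proj₁ (H-conn h₁ h₂)))

{-# OPTIONS --safe #-}
-- Lower bound: a rainbow path has at most as many edges as there are colours,
-- so no distance exceeds rc.
-- Upper bound: let (r , s) be a centre of G □ H.  Projecting walks to the factors
-- gives ecc r + ecc s ≤ radius.  Colouring each edge of G by its depth below r uses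
-- ecc r colours and makes every geodesic to r rainbow; likewise for H and s.  In the
-- product use two disjoint copies of each palette, one for the layers through r or s
-- and the other for the remaining layers.  A route from (g₁ , h₁) to (g₂ , h₂) then
-- goes through (r , h₁), (r , s) and (g₂ , s), and is rainbow if h₁ ≢ s and g₂ ≢ r.
-- If this fails in both directions, then either both ends lie in the same layer
-- through the centre, where a detour through another layer helps, or one of the ends
-- is the centre itself.
module Submission where

open import Defs
open import Data.Nat.Base using (NonTrivial; _≤_; _*_)
open import Data.Product.Base using (_×_)

open import Data.Bool.Base using (Bool; true; false)
import Data.Bool.Properties as Bool
open import Data.Fin.Base as Fin using (Fin; combine; fromℕ<; toℕ)
import Data.Fin.Properties as Fin
open import Data.List.Base as List using (List; []; _∷_)
import Data.List.Extrema.Nat as Extrema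
open import Data.List.Membership.Propositional using (_∈_)
open import Data.List.Membership.Propositional.Properties using (∈-map⁺; ∈-map⁻; ∈-tabulate⁺)
import Data.List.Membership.DecPropositional as DecMembership
open import Data.List.Relation.Binary.Permutation.Propositional
  using (_↭_; prep; ↭-refl; ↭-trans; ↭⇒↭ₛ)
open import Data.List.Relation.Binary.Permutation.Propositional.Properties using (∷↭∷ʳ; ↭-length)
import Data.List.Relation.Binary.Permutation.Setoid.Properties as Permutation
open import Data.List.Relation.Binary.Sublist.Propositional using (_⊆_; []; _∷_; _∷ʳ_; ⊆-refl; ⊆-trans)
open import Data.List.Relation.Binary.Sublist.Propositional.Properties using (All-resp-⊆; length-mono-≤)
open import Data.List.Relation.Unary.All as All using (All; []; _∷_)
import Data.List.Relation.Unary.All.Properties as All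
open import Data.List.Relation.Unary.Any using (here; there)
open import Data.List.Relation.Unary.AllPairs using ([]; _∷_)
open import Data.List.Relation.Unary.Unique.Propositional using (Unique)
import Data.List.Relation.Unary.Unique.Propositional.Properties as Unique
import Data.List.Relation.Unary.Unique.DecPropositional as DecUnique
open import Data.Nat.Base using (ℕ; suc; pred; _+_; _<_; _⊔_; s≤s; s≤s⁻¹; nonTrivial⇒n>1; ≢-nonZero)
import Data.Nat.Properties as ℕ
open import Data.Product.Base using (∃-syntax; _,_; proj₁; proj₂)
open import Data.Product.Properties using (≡-dec; ,-injectiveʳ)
open import Data.Sum.Base using (_⊎_; inj₁; inj₂)
open import Data.Sum.Properties using (inj₁-injective; inj₂-injective)
open import Data.Unit.Base using (⊤; tt)
open import Function.Base using (_∘_)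
open import Function.Bundles using (_↣_; Injection; Inverse; mk↣)
open import Function.Construct.Symmetry using (↔-sym)
open import Function.Properties.Inverse using (↔⇒↣)
open import Relation.Binary.PropositionalEquality
  using (_≡_; _≢_; refl; sym; trans; cong; cong₂; subst; subst₂; setoid)
open import Relation.Nullary.Decidable using (yes; no; does; True; toWitness; dec-true; dec-false)
open import Relation.Nullary.Negation.Core using (contradiction)

open Graph using (V; order)
open EdgeColouring
open Least

-- Lists without repetitions, and a second vertex.

Unique-resp-⊇ : {A : Set} {xs ys : List A} → xs ⊆ ys → Unique ys → Unique xs
Unique-resp-⊇ []         []        = []
Unique-resp-⊇ (_ ∷ʳ s)   (_ ∷ ys!) = Unique-resp-⊇ s ys!
Unique-resp-⊇ (refl ∷ s) (y∉ ∷ ys!) = All-resp-⊆ s y∉ ∷ Unique-resp-⊇ s ys!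

Unique-resp-↭ : {A : Set} {xs ys : List A} → xs ↭ ys → Unique xs → Unique ys
Unique-resp-↭ p = Permutation.Unique-resp-↭ (setoid _) (↭⇒↭ₛ p)

other : ∀ {n} → 1 < n → (i : Fin n) → ∃[ j ] j ≢ i
other (s≤s (s≤s _)) i = Fin.punchIn i Fin.zero , Fin.punchInᵢ≢i i Fin.zero

-- Supplies the layers off the centre that the detours use.
otherVertex : (G : Graph) → 1 < order G → (v : V G) → ∃[ w ] w ≢ v
otherVertex G 1<n v =
  let j , j≢i = other 1<n (index v)
  in vertex j , λ eq → j≢i (trans (sym (Inverse.strictlyInverseˡ finite j)) (cong index eq))
  where open Graph G

-- Vertices may repeat, since shortcutting to a path keeps the labels distinct. Labels lie in any
-- type `A`, so that colours can stay structured until they are counted.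
RainbowWalk : (G : Graph) {A : Set} → (∀ u v → .(Graph.Adj G u v) → A) → V G → V G → Set
RainbowWalk G f u v = ∃[ p ] Unique (labels {G} f {u} {v} p)

-- Reversing walks and shortcutting them to paths.

module _ {G : Graph} where
  open Graph G hiding (V; order)

  reverse : ∀ {u v} → Walk G u v → Walk G v u
  reverse []      = []
  reverse (e ∷ p) = reverse p ++ (adj-sym e ∷ [])

  module _ {A : Set} (f : ∀ u v → .(Adj u v) → A) where

    length-labels : ∀ {u v} (p : Walk G u v) → List.length (labels f p) ≡ length p
    length-labels []      = refl
    length-labels (_ ∷ p) = cong suc (length-labels p)

    labels-++ : ∀ {u v w} (p : Walk G u v) (q : Walk G v w) →
                labels f (p ++ q) ≡ labels f p List.++ labels f q
    labels-++ []      q = refl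
    labels-++ (e ∷ p) q = cong (_ ∷_) (labels-++ p q)

    labels-reverse : (∀ {u v} (e : Adj u v) → f u v e ≡ f v u (adj-sym e)) →
                     ∀ {u v} (p : Walk G u v) → labels f p ↭ labels f (reverse p)
    labels-reverse f-sym []      = ↭-refl
    labels-reverse f-sym (e ∷ p)
      rewrite labels-++ (reverse p) (adj-sym e ∷ []) | f-sym e =
      ↭-trans (prep _ (labels-reverse f-sym p)) (∷↭∷ʳ _ _)

    labels-suffix : ∀ {x u v} (p : Walk G u v) (p! : IsPath p) (x∈p : x ∈ vertices p) →
                    labels f (proj₁ (suffix p p! x∈p)) ⊆ labels f p
    labels-suffix []      p!       (here refl) = ⊆-refl
    labels-suffix (e ∷ p) p!       (here refl) = ⊆-refl
    labels-suffix (e ∷ p) (_ ∷ p!) (there x∈p) = _ ∷ʳ labels-suffix p p! x∈p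

    -- Shortcutting only deletes edges. As a sublist, the labels stay distinct and do not grow in
    -- number.
    labels-walk⇒path : ∀ {u v} (p : Walk G u v) →
                       labels f (proj₁ (walk⇒path p)) ⊆ labels f p
    labels-walk⇒path [] = []
    labels-walk⇒path {u} (e ∷ p) with walk⇒path p | labels-walk⇒path p
    ... | q , q! | q⊆p with DecMembership._∈?_ _≟_ u (vertices q)
    ...   | yes u∈q = _ ∷ʳ ⊆-trans (labels-suffix q q! u∈q) q⊆p
    ...   | no  _   = refl ∷ q⊆p

    rainbowWalk-sym : (∀ {u v} (e : Adj u v) → f u v e ≡ f v u (adj-sym e)) →
                      ∀ {u v} → RainbowWalk G f u v → RainbowWalk G f v u
    rainbowWalk-sym f-sym (p , p!) = reverse p , Unique-resp-↭ (labels-reverse f-sym p) p!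

  private
    -- A constant labelling turns facts about label lists into facts about lengths.
    unlabelled : ∀ u v → .(Adj u v) → ⊤
    unlabelled _ _ _ = tt

  length-reverse : ∀ {u v} (p : Walk G u v) → length (reverse p) ≡ length p
  length-reverse p = trans (sym (length-labels unlabelled (reverse p)))
    (trans (sym (↭-length (labels-reverse unlabelled (λ _ → refl) p))) (length-labels unlabelled p))

  length-walk⇒path : ∀ {u v} (p : Walk G u v) → length (proj₁ (walk⇒path p)) ≤ length p
  length-walk⇒path p = subst₂ _≤_
    (length-labels unlabelled (proj₁ (walk⇒path p))) (length-labels unlabelled p)
    (length-mono-≤ (labels-walk⇒path unlabelled p))

  module _ {A : Set} {f : ∀ u v → .(Adj u v) → A} where

    labels-map : {B : Set} (ι : A → B) → ∀ {u v} (p : Walk G u v) →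
                 labels (λ u v e → ι (f u v e)) p ≡ List.map ι (labels f p)
    labels-map ι []      = refl
    labels-map ι (e ∷ p) = cong (_ ∷_) (labels-map ι p)

    rainbowWalks⇒rainbowColourable :
      ∀ {k} → A ↣ Fin k →
      (∀ {u v} (e : Adj u v) → f u v e ≡ f v u (adj-sym e)) →
      (∀ u v → RainbowWalk G f u v) → RainbowColourable G k
    rainbowWalks⇒rainbowColourable {k} ι f-sym walks = c , λ u v →
      let p , p! = walks u v; q , q! = walk⇒path p
      in q , q! , subst Unique (sym (labels-map to q))
           (Unique.map⁺ injective (Unique-resp-⊇ (labels-walk⇒path f p) p!))
      where
      open Injection ι using (to; injective)

      c : EdgeColouring G k
      c = record { colour = λ u v e → to (f u v e) ; colour-sym = λ e → cong to (f-sym e) }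

-- Eccentricity and the lower bound.

module _ (G : Graph) (conn : Connected G) where
  open Graph G hiding (V; order)

  dist≤length : ∀ {u v} (p : Walk G u v) → dist G conn u v ≤ length p
  dist≤length {u} {v} p = ℕ.≤-trans
    (minimal (distance G conn u v) (_ , refl , proj₂ (walk⇒path p)))
    (length-walk⇒path p)

  dist-refl : ∀ v → dist G conn v v ≡ 0
  dist-refl v = ℕ.n≤0⇒n≡0 (dist≤length [])

  dist≤ecc : ∀ u v → dist G conn u v ≤ ecc G conn u
  dist≤ecc u v = All.lookup (Extrema.xs≤max 0 _) (∈-map⁺ (dist G conn u)
    (subst (_∈ allVertices) (vertex-index v) (∈-tabulate⁺ (index v))))

  ecc-attained : ∀ u → ∃[ v ] dist G conn u v ≡ ecc G conn u
  ecc-attained u with Extrema.argmax-sel (λ d → d) 0 (List.map (dist G conn u) allVertices)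
  -- The maximum can be its default 0, which `u` itself attains.
  ... | inj₁ eq = u , trans (dist-refl u) (sym eq)
  ... | inj₂ ecc∈ = let v , _ , eq = ∈-map⁻ (dist G conn u) ecc∈ in v , sym eq

  ecc≤ : ∀ {u m} → (∀ v → dist G conn u v ≤ m) → ecc G conn u ≤ m
  ecc≤ {u} d≤m = let v , eq = ecc-attained u in subst (_≤ _) eq (d≤m v)

  rainbow⇒ecc≤ : ∀ {k} → RainbowColourable G k → ∀ u → ecc G conn u ≤ k
  rainbow⇒ecc≤ {k} (c , rainbow) u = ecc≤ λ v →
    let p , _ , p! = rainbow u v
    in ℕ.≤-trans (dist≤length p) (subst (_≤ k) (length-labels (colour c) p)
         -- Distinct labels make `lookup` an injection from positions to colours, so there are at
         -- most `k` edges.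
         (Fin.injective⇒≤ (lookup-unique G p!)))

  -- Colouring edges by depth below a root.

  module _ (r : V G) where

    depth : V G → ℕ
    depth = dist G conn r

    geodesic : ∀ v → ∃[ p ] length {G} {v} {r} p ≡ depth v
    geodesic v = let p , eq , _ = holds (distance G conn r v)
                 in reverse p , trans (length-reverse p) eq

    depth≤length : ∀ {v} (p : Walk G v r) → depth v ≤ length p
    depth≤length p = subst (_ ≤_) (length-reverse p) (dist≤length (reverse p))

    depth≡0⇒≡ : ∀ {v} → depth v ≡ 0 → v ≡ r
    depth≡0⇒≡ {v} eq with geodesic v
    ... | []    , _   = refl
    ... | _ ∷ _ , eq′ = contradiction (trans eq′ eq) λ ()

    -- An edge with both ends at depth 0 would be a loop at `r`. So the larger depth is positive and
    -- `pred` makes it strictly smaller.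
    edgeDepth<ecc : ∀ {v w} → Adj v w → pred (depth v ⊔ depth w) < ecc G conn r
    edgeDepth<ecc {v} {w} e = ℕ.<-≤-trans
      (ℕ.≤-reflexive (ℕ.suc-pred (depth v ⊔ depth w) {{≢-nonZero max≢0}}))
      (ℕ.⊔-lub (dist≤ecc r v) (dist≤ecc r w))
      where
      max≢0 : depth v ⊔ depth w ≢ 0
      max≢0 eq = irrefl (subst (λ x → Adj x w) (trans v≡r (sym w≡r)) e)
        where
        v≡r = depth≡0⇒≡ (ℕ.n≤0⇒n≡0 (subst (depth v ≤_) eq (ℕ.m≤m⊔n (depth v) (depth w))))
        w≡r = depth≡0⇒≡ (ℕ.n≤0⇒n≡0 (subst (depth w ≤_) eq (ℕ.m≤n⊔m (depth v) (depth w))))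

    -- Edges between levels i and i + 1, and edges within level i + 1, get colour i.
    depthColouring : EdgeColouring G (ecc G conn r)
    depthColouring = record
      { colour     = λ v w e → fromℕ< (edgeDepth<ecc e)
      ; colour-sym = λ {v} {w} _ → Fin.fromℕ<-cong _ _ (cong pred (ℕ.⊔-comm (depth v) (depth w))) _ _
      }

    -- The first colour is the length of the rest, whose colours are all smaller; the bound on the
    -- colours carries the induction.
    geodesic-labels : ∀ {v} (p : Walk G v r) → length p ≡ depth v →
                      All (λ i → toℕ i < length p) (labels (colour depthColouring) p) ×
                      Unique (labels (colour depthColouring) p)
    geodesic-labels [] _ = [] , []
    geodesic-labels {v} (_∷_ {w = w} e p) eq =
      let p< , p! = geodesic-labels p length≡
      in subst (_< suc (length p)) (sym label≡) (ℕ.n<1+n _) ∷ All.map ℕ.m<n⇒m<1+n p< ,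
         All.map (λ i< i≡ → ℕ.<-irrefl (trans (cong toℕ (sym i≡)) label≡) i<) p< ∷ p!
      where
      length≡ : length p ≡ depth w
      length≡ = ℕ.≤-antisym
        -- A geodesic from `w`, extended by `e`, bounds `depth v`; hence the tail `p` is no longer
        -- than `depth w`.
        (let q , eq′ = geodesic w
         in s≤s⁻¹ (subst (suc (length p) ≤_) (cong suc eq′)
              (subst (_≤ _) (sym eq) (depth≤length (e ∷ q)))))
        (depth≤length p)

      label≡ : toℕ (colour depthColouring v w e) ≡ length p
      label≡ = trans (Fin.toℕ-fromℕ< _) (trans
        (cong₂ (λ m n → pred (m ⊔ n)) (sym eq) (sym length≡))
        (cong pred (ℕ.m≥n⇒m⊔n≡m (ℕ.n≤1+n (length p)))))

    depthColouring-rainbow : ∀ v → RainbowWalk G (colour depthColouring) v r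
    depthColouring-rainbow v = let p , eq = geodesic v in p , proj₂ (geodesic-labels p eq)

-- Projecting product walks to the factors.

module _ {G H : Graph} where

  -- Each product edge moves exactly one coordinate, so the lengths add up exactly.
  project : ∀ {g₁ g₂ h₁ h₂} (p : Walk (G □ H) (g₁ , h₁) (g₂ , h₂)) →
            ∃[ q ] ∃[ q′ ] length {G} {g₁} {g₂} q + length {H} {h₁} {h₂} q′ ≡ length p
  project [] = [] , [] , refl
  project (inj₁ (refl , e) ∷ p) =
    let q , q′ , eq = project p in q , e ∷ q′ , trans (ℕ.+-suc _ _) (cong suc eq)
  project (inj₂ (refl , e) ∷ p) =
    let q , q′ , eq = project p in e ∷ q , q′ , cong suc eq

  -- Farthest vertices from `g` and `h` pair to a vertex at distance at least the sum.
  ecc-+ : ∀ G-conn H-conn conn g h →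
          ecc G G-conn g + ecc H H-conn h ≤ ecc (G □ H) conn (g , h)
  ecc-+ G-conn H-conn conn g h =
    let g′ , eqᴳ = ecc-attained G G-conn g
        h′ , eqᴴ = ecc-attained H H-conn h
        p , eq , _ = holds (distance (G □ H) conn (g , h) (g′ , h′))
        q , q′ , eq′ = project p
    in begin
      ecc G G-conn g + ecc H H-conn h          ≡⟨ cong₂ _+_ eqᴳ eqᴴ ⟨
      dist G G-conn g g′ + dist H H-conn h h′  ≤⟨ ℕ.+-mono-≤ (dist≤length G G-conn q) (dist≤length H H-conn q′) ⟩
      length q + length q′                     ≡⟨ trans eq′ eq ⟩
      dist (G □ H) conn (g , h) (g′ , h′)      ≤⟨ dist≤ecc (G □ H) conn (g , h) (g′ , h′) ⟩
      ecc (G □ H) conn (g , h)                 ∎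
    where open ℕ.≤-Reasoning

-- Colouring the product.

module Product
  {G H : Graph} {r : V G} {s : V H} {a b} (c : EdgeColouring G a) (d : EdgeColouring H b)
  (to-r : ∀ g → RainbowWalk G (colour c) g r) (to-s : ∀ h → RainbowWalk H (colour d) h s)
  (r′ : ∃[ g ] g ≢ r) (s′ : ∃[ h ] h ≢ s)
  where

  private
    module G = Graph G
    module H = Graph H
    module G□H = Graph (G □ H)

  from-r : ∀ g → RainbowWalk G (colour c) r g
  from-r g = rainbowWalk-sym {G} (colour c) (colour-sym c) (to-r g)

  from-s : ∀ h → RainbowWalk H (colour d) s h
  from-s h = rainbowWalk-sym {H} (colour d) (colour-sym d) (to-s h)

  -- The boolean tells whether the edge lies in a layer through the centre.
  Colour : Set
  Colour = Bool × (Fin a ⊎ Fin b)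

  edgeˡ : ∀ {g₁ g₂ h₁ h₂} → g₁ ≢ g₂ → G□H.Adj (g₁ , h₁) (g₂ , h₂) → G.Adj g₁ g₂
  edgeˡ g₁≢g₂ (inj₁ (g₁≡g₂ , _)) = contradiction g₁≡g₂ g₁≢g₂
  edgeˡ g₁≢g₂ (inj₂ (_ , e))     = e

  edgeʳ : ∀ {g₁ g₂ h₁ h₂} → g₁ ≡ g₂ → G□H.Adj (g₁ , h₁) (g₂ , h₂) → H.Adj h₁ h₂
  edgeʳ refl (inj₁ (_ , e)) = e
  edgeʳ refl (inj₂ (_ , e)) = contradiction e G.irrefl

  -- The adjacency proof is irrelevant, so the direction of the edge is found by comparing first
  -- coordinates.
  productColour : ∀ x y → .(G□H.Adj x y) → Colour
  productColour (g₁ , h₁) (g₂ , h₂) e with g₁ G.≟ g₂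
  ... | yes g₁≡g₂ = does (g₁ G.≟ r) , inj₂ (colour d h₁ h₂ (edgeʳ g₁≡g₂ e))
  ... | no  g₁≢g₂ = does (h₁ H.≟ s) , inj₁ (colour c g₁ g₂ (edgeˡ g₁≢g₂ e))

  productColourˡ : ∀ h {g₁ g₂} (e : G.Adj g₁ g₂) →
    productColour (g₁ , h) (g₂ , h) (inj₂ (refl , e)) ≡ (does (h H.≟ s) , inj₁ (colour c g₁ g₂ e))
  productColourˡ h {g₁} {g₂} e with g₁ G.≟ g₂
  ... | yes refl = contradiction e G.irrefl
  ... | no  _    = refl

  productColourʳ : ∀ g {h₁ h₂} (e : H.Adj h₁ h₂) →
    productColour (g , h₁) (g , h₂) (inj₁ (refl , e)) ≡ (does (g G.≟ r) , inj₂ (colour d h₁ h₂ e))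
  productColourʳ g e with g G.≟ g
  ... | yes _   = refl
  ... | no  g≢g = contradiction refl g≢g

  productColour-sym : ∀ {x y} (e : G□H.Adj x y) →
                      productColour x y e ≡ productColour y x (G□H.adj-sym {x} {y} e)
  productColour-sym {g , _} (inj₁ (refl , e)) = trans (productColourʳ g e)
    (trans (cong (λ i → _ , inj₂ i) (colour-sym d e)) (sym (productColourʳ g (H.adj-sym e))))
  productColour-sym {_ , h} (inj₂ (refl , e)) = trans (productColourˡ h e)
    (trans (cong (λ i → _ , inj₁ i) (colour-sym c e)) (sym (productColourˡ h (G.adj-sym e))))

  -- Walks inside layers.

  colours : ∀ {x y} → Walk (G □ H) x y → List Colour
  colours = labels {G □ H} productColour

  colours-walkˡ : ∀ h {g₁ g₂} (p : Walk G g₁ g₂) → colours (walkˡ {G} {H} h p) ≡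
                 List.map (λ i → does (h H.≟ s) , inj₁ i) (labels (colour c) p)
  colours-walkˡ h []      = refl
  colours-walkˡ h (e ∷ p) = cong₂ _∷_ (productColourˡ h e) (colours-walkˡ h p)

  colours-walkʳ : ∀ g {h₁ h₂} (p : Walk H h₁ h₂) → colours (walkʳ {G} {H} g p) ≡
                 List.map (λ i → does (g G.≟ r) , inj₂ i) (labels (colour d) p)
  colours-walkʳ g []      = refl
  colours-walkʳ g (e ∷ p) = cong₂ _∷_ (productColourʳ g e) (colours-walkʳ g p)

  -- The second boolean is true for colours of edges of G.
  Palette : Set
  Palette = Bool × Bool

  palette : Colour → Palette
  palette (t , inj₁ _) = t , true
  palette (t , inj₂ _) = t , false

  -- The walk may be empty, so routes need no case split when two corners coincide.
  Segment : Palette → V (G □ H) → V (G □ H) → Set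
  Segment κ x y = ∃[ p ] Unique (colours {x} {y} p) ×
                         All (λ i → palette i ≡ κ) (colours p)

  segmentˡ : ∀ {t g₁ g₂ h} → does (h H.≟ s) ≡ t → RainbowWalk G (colour c) g₁ g₂ →
             Segment (t , true) (g₁ , h) (g₂ , h)
  segmentˡ {h = h} refl (p , p!) = walkˡ h p ,
    subst Unique (sym (colours-walkˡ h p)) (Unique.map⁺ (inj₁-injective ∘ ,-injectiveʳ) p!) ,
    subst (All _) (sym (colours-walkˡ h p)) (All.map⁺ (All.universal (λ _ → refl) _))

  segmentʳ : ∀ {t g h₁ h₂} → does (g G.≟ r) ≡ t → RainbowWalk H (colour d) h₁ h₂ →
             Segment (t , false) (g , h₁) (g , h₂)
  segmentʳ {g = g} refl (p , p!) = walkʳ g p ,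
    subst Unique (sym (colours-walkʳ g p)) (Unique.map⁺ (inj₂-injective ∘ ,-injectiveʳ) p!) ,
    subst (All _) (sym (colours-walkʳ g p)) (All.map⁺ (All.universal (λ _ → refl) _))

  -- Joining segments with distinct palettes.

  infixr 5 _∷_

  data Route : List Palette → V (G □ H) → V (G □ H) → Set where
    []  : ∀ {x} → Route [] x x
    _∷_ : ∀ {κ κs x y z} → Segment κ x y → Route κs y z → Route (κ ∷ κs) x z

  -- Colours of different palettes differ, so segments with distinct palettes share none; the last
  -- component tracks this through the induction.
  route-rainbow : ∀ {κs x y} → Route κs x y → Unique κs →
                  ∃[ p ] Unique (colours {x} {y} p) ×
                         All (λ i → palette i ∈ κs) (colours p)
  route-rainbow [] _ = [] , [] , []
  route-rainbow ((p , p! , p∈) ∷ R) (κ∉ ∷ κs!) =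
    let q , q! , q∈ = route-rainbow R κs!
    in p ++ q ,
       subst Unique (sym (labels-++ {G □ H} productColour p q))
         (Unique.++⁺ p! q! λ (i∈p , i∈q) →
           All.lookup κ∉ (All.lookup q∈ i∈q) (sym (All.lookup p∈ i∈p))) ,
       subst (All _) (sym (labels-++ {G □ H} productColour p q))
         (All.++⁺ (All.map here p∈) (All.map there q∈))

  distinct? = DecUnique.unique? (≡-dec Bool._≟_ Bool._≟_)

  -- The palettes of a concrete route are closed terms, so the implicit argument is solved by
  -- evaluation.
  rainbow : ∀ {κs x y} → Route κs x y → {True (distinct? κs)} →
            RainbowWalk (G □ H) productColour x y
  rainbow R {κs!} = let p , p! , _ = route-rainbow R (toWitness κs!) in p , p!

  -- Rainbow walks between all pairs.

  through-centre : ∀ {g₁ h₁ g₂ h₂} → h₁ ≢ s → g₂ ≢ r →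
                   RainbowWalk (G □ H) productColour (g₁ , h₁) (g₂ , h₂)
  through-centre {g₁} {h₁} {g₂} {h₂} h₁≢s g₂≢r = rainbow
    -- Each of the four palettes occurs once: the outer legs avoid the layers through the centre,
    -- the inner legs lie in them.
    ( segmentˡ (dec-false (h₁ H.≟ s) h₁≢s) (to-r g₁)
    ∷ segmentʳ (dec-true (r G.≟ r) refl) (to-s h₁)
    ∷ segmentˡ (dec-true (s H.≟ s) refl) (from-r g₂)
    ∷ segmentʳ (dec-false (g₂ G.≟ r) g₂≢r) (from-s h₂)
    ∷ [])

  from-centre : ∀ g h → RainbowWalk (G □ H) productColour (r , s) (g , h)
  from-centre g h with g G.≟ r
  ... | yes refl = rainbow (segmentʳ (dec-true (r G.≟ r) refl) (from-s h) ∷ [])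
  ... | no g≢r   = rainbow
    (segmentˡ (dec-true (s H.≟ s) refl) (from-r g) ∷ segmentʳ (dec-false (g G.≟ r) g≢r) (from-s h) ∷ [])

  symmetric : ∀ {x y} → RainbowWalk (G □ H) productColour x y → RainbowWalk (G □ H) productColour y x
  symmetric = rainbowWalk-sym {G □ H} productColour λ {x} {y} → productColour-sym {x} {y}

  -- Going straight from `r` to `g₂` could repeat colours of the leg to `r`; the detour through the
  -- layer of some `h` other than `s` gives that leg the other palette.
  within-s-layer : ∀ g₁ {g₂} → g₂ ≢ r → RainbowWalk (G □ H) productColour (g₁ , s) (g₂ , s)
  within-s-layer g₁ {g₂} g₂≢r = let h , h≢s = s′ in rainbow
    ( segmentˡ (dec-true (s H.≟ s) refl) (to-r g₁)
    ∷ segmentʳ (dec-true (r G.≟ r) refl) (from-s h)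
    ∷ segmentˡ (dec-false (h H.≟ s) h≢s) (from-r g₂)
    ∷ segmentʳ (dec-false (g₂ G.≟ r) g₂≢r) (to-s h)
    ∷ [])

  within-r-layer : ∀ h₁ {h₂} → h₂ ≢ s → RainbowWalk (G □ H) productColour (r , h₁) (r , h₂)
  within-r-layer h₁ {h₂} h₂≢s = let g , g≢r = r′ in rainbow
    ( segmentʳ (dec-true (r G.≟ r) refl) (to-s h₁)
    ∷ segmentˡ (dec-true (s H.≟ s) refl) (from-r g)
    ∷ segmentʳ (dec-false (g G.≟ r) g≢r) (from-s h₂)
    ∷ segmentˡ (dec-false (h₂ H.≟ s) h₂≢s) (to-r g)
    ∷ [])

  rainbowWalks : ∀ x y → RainbowWalk (G □ H) productColour x y
  rainbowWalks (g₁ , h₁) (g₂ , h₂) with g₁ G.≟ r | h₁ H.≟ s | g₂ G.≟ r | h₂ H.≟ s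
  ... | yes refl | yes refl | _        | _        = from-centre g₂ h₂
  ... | _        | _        | yes refl | yes refl = symmetric (from-centre g₁ h₁)
  ... | _        | no h₁≢s  | no g₂≢r  | _        = through-centre h₁≢s g₂≢r
  ... | no g₁≢r  | _        | _        | no h₂≢s  = symmetric (through-centre h₂≢s g₁≢r)
  -- Neither end is the centre and both routes through it fail, so both ends share `s` or both share
  -- `r`.
  ... | _        | yes refl | no g₂≢r  | yes refl = within-s-layer g₁ g₂≢r
  ... | yes refl | _        | yes refl | no h₂≢s  = within-r-layer h₁ h₂≢s

  -- Counting the colours.

  encode : ∀ {m} → a + b ≤ m → Colour ↣ Fin (2 * m)
  encode {m} a+b≤m = mk↣ {to = to} injective
    where
    bit : Bool → Fin 2
    bit false = Fin.zero
    bit true  = Fin.suc Fin.zero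

    bit-injective : ∀ {t u} → bit t ≡ bit u → t ≡ u
    bit-injective {false} {false} _ = refl
    bit-injective {true}  {true}  _ = refl

    to : Colour → Fin (2 * m)
    -- The bit picks one of two copies of the a + b factor colours, padded to `m`.
    to (t , i) = combine (bit t) (Fin.inject≤ (Fin.join a b i) a+b≤m)

    injective : ∀ {i j} → to i ≡ to j → i ≡ j
    injective {t , i} {u , j} eq =
      let eq₁ , eq₂ = Fin.combine-injective (bit t) _ (bit u) _ eq
      in cong₂ _,_ (bit-injective eq₁)
           (Injection.injective (↔⇒↣ (↔-sym (Fin.+↔⊎ {a} {b})))
             (Fin.inject≤-injective a+b≤m a+b≤m _ _ eq₂))

  □-rainbowColourable : ∀ {m} → a + b ≤ m → RainbowColourable (G □ H) (2 * m)
  □-rainbowColourable a+b≤m = rainbowWalks⇒rainbowColourable {G □ H} (encode a+b≤m)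
    (λ {x} {y} → productColour-sym {x} {y}) rainbowWalks

-- Both bounds at a centre of the product.

theorem2 : (G′ H′ : Graph) →
    .{{_ : NonTrivial (Graph.order G′)}} → .{{_ : NonTrivial (Graph.order H′)}} →
    (G′-conn : Connected G′) (H′-conn : Connected H′) →
    let conn = □-connected G′-conn H′-conn in
    radius (G′ □ H′) conn ≤ rc (G′ □ H′) conn ×
    rc (G′ □ H′) conn ≤ 2 * radius (G′ □ H′) conn
theorem2 G′ H′ G′-conn H′-conn =
  let conn = □-connected G′-conn H′-conn
      (r , s) , ecc≡radius = holds (radiusLeast (G′ □ H′) conn)
  in subst (_≤ rc (G′ □ H′) conn) ecc≡radius
       (rainbow⇒ecc≤ (G′ □ H′) conn (holds (rcLeast (G′ □ H′) conn)) (r , s)) ,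
     minimal (rcLeast (G′ □ H′) conn)
       (Product.□-rainbowColourable
         (depthColouring G′ G′-conn r) (depthColouring H′ H′-conn s)
         (depthColouring-rainbow G′ G′-conn r) (depthColouring-rainbow H′ H′-conn s)
         (otherVertex G′ (nonTrivial⇒n>1 (order G′)) r)
         (otherVertex H′ (nonTrivial⇒n>1 (order H′)) s)
         -- The two palettes together have at most radius many colours, since `(r , s)` attains the
         -- radius.
         (subst (ecc G′ G′-conn r + ecc H′ H′-conn s ≤_) ecc≡radius
           (ecc-+ G′-conn H′-conn conn r s)))
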